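{- Let $X$ be a non-empty set and let $S\subseteq \mathrm{Der}(X)$ be finite and non-empty. Then the derangement action digraph $\overrightarrow{\mathrm{DA}}(X,S)$ is a simple graph (that is, its arc set is symmetric) which is regular of valency $|S|$ if and only if $S$ is closed.
   Context: For a set $X$, $\mathrm{Sym}(X)$ is the group of all permutations of $X$, acting on the right: $x^s$ is the image of $x$ under $s$, and $x^{st}=(x^s)^t$. A derangement of $X$ is a permutation of $X$ with no fixed points; $\mathrm{Der}(X)$ is the set of derangements of $X$. For $A,B\subseteq\mathrm{Sym}(X)$, $AB=\{ab : a\in A,b\in B\}$ and $A^{ -1}=\{a^{ -1}: a\in A\}$; for $x\in X$, $x^A=\{x^a: a\in A\}$; $1$ denotes the identity permutation. A simple digraph is a pair $(X,A)$ with vertex set $X$ and arc set $A\subseteq\{(u,v): u,v\in X, u\neq v\}$. It is regular of valency $k$ if every vertex $x$ has exactly $k$ out-neighbours ($y$ with $(x,y)\in A$) and exactly $k$ in-neighbours ($y$ with $(y,x)\in A$). It is a simple graph if $A$ is symmetric: $(x,y)\in A$ implies $(y,x)\in A$. For non-empty $X$ and non-empty $S\subseteq \mathrm{Der}(X)$, the derangement action digraph $\overrightarrow{\mathrm{DA}}(X,S)$ is the simple digraph with vertex set $X$ and arc set $\{(x,x^s): x\in X, s\in S\}$. When it is a simple graph it is called a derangement action graph. A non-empty subset $S\subseteq\mathrm{Der}(X)$ is closed if both (1) $x^S=x^{S^{ -1}}$ for each $x\in X$, and (2) $SS^{ -1}\subseteq\mathrm{Der}(X)\cup\{1\}$. 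-}

module Defs where

open import Algebra.Bundles using (Group)
open import Data.Fin.Base using (Fin)
open import Data.Nat.Base using (ℕ)
open import Data.Product.Base using (∃; ∃₂; _×_; _,_; proj₁)
open import Function.Bundles using (_↔_; Inverse; Bijection)
open import Function.Construct.Identity using (↔-id)
open import Function.Properties.Inverse using (↔-sym; ↔-trans)
open import Level using (Level; _⊔_; suc)
open import Relation.Binary.Bundles using (Setoid)
open import Relation.Binary.Core using (Rel)
open import Relation.Binary.Definitions using (Irreflexive; Symmetric)
import Relation.Binary.Construct.On as On
open import Relation.Binary.PropositionalEquality
  using (_≡_; _≢_; refl; sym; trans; cong; setoid)
open import Relation.Unary using (Pred; _∈_; _⊆_; _≐_; _∪_)

private
  variable
    a ℓ ℓ₁ ℓ₂ : Level

-- The subset P of A has exactly n elements, counted up to the equality of A.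
-- The proofs of membership in P are ignored by the setoid structure on Σ A P.
HasSize : (A : Setoid a ℓ₁) → Pred (Setoid.Carrier A) ℓ₂ → ℕ → Set (a ⊔ ℓ₁ ⊔ ℓ₂)
HasSize A P n = Bijection (setoid (Fin n)) (On.setoid A (proj₁ {B = P}))

infixl 8 _^_

_^_ : {X : Set a} → X → X ↔ X → X
x ^ s = Inverse.to s x

-- ↔-trans s t applies s first, so that x ^ (s ∙ t) is (x ^ s) ^ t.
-- Permutations are equal when they agree at every point.
Sym : Set a → Group a a
Sym X = record
  { Carrier = X ↔ X
  ; _≈_     = λ s t → ∀ x → x ^ s ≡ x ^ t
  ; _∙_     = ↔-trans
  ; ε       = ↔-id X
  ; _⁻¹     = ↔-sym
  ; isGroup = record
    { isMonoid = record
      { isSemigroup = record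
        { isMagma = record
          { isEquivalence = record
            { refl  = λ x → refl
            ; sym   = λ p x → sym (p x)
            ; trans = λ p q x → trans (p x) (q x)
            }
          ; ∙-cong = λ {s} {t} {u} {v} p q x → trans (cong (_^ u) (p x)) (q (x ^ t))
          }
        ; assoc = λ s t u x → refl
        }
      ; identity = (λ s x → refl) , (λ s x → refl)
      }
    ; inverse = (λ s → Inverse.strictlyInverseˡ s) , (λ s → Inverse.strictlyInverseʳ s)
    ; ⁻¹-cong = λ {s} {t} p x →
        trans (cong (_^ ↔-sym s) (sym (trans (p (x ^ ↔-sym t)) (Inverse.strictlyInverseˡ t x))))
              (Inverse.strictlyInverseʳ s (x ^ ↔-sym t))
    }
  }

module _ {X : Set a} where

  open Group (Sym X) using (Carrier; _≈_; _∙_; _⁻¹; ε)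

  infixl 8 _^ˢ_

  Der : Pred Carrier a
  Der s = ∀ x → x ^ s ≢ x

  _·_ : Pred Carrier ℓ₁ → Pred Carrier ℓ₂ → Pred Carrier (a ⊔ ℓ₁ ⊔ ℓ₂)
  (A · B) p = ∃₂ λ s t → s ∈ A × t ∈ B × p ≈ s ∙ t

  Inv : Pred Carrier ℓ → Pred Carrier (a ⊔ ℓ)
  Inv A p = ∃ λ s → s ∈ A × p ≈ s ⁻¹

  -- ｛_｝ from Relation.Unary would use propositional equality of permutations.
  ｛1｝ : Pred Carrier a
  ｛1｝ p = p ≈ ε

  _^ˢ_ : X → Pred Carrier ℓ → Pred X (a ⊔ ℓ)
  (x ^ˢ A) y = ∃ λ s → s ∈ A × y ≡ x ^ s

  record Closed (S : Pred Carrier ℓ) : Set (a ⊔ ℓ) where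
    field
      inverse-images : ∀ x → x ^ˢ S ≐ x ^ˢ Inv S
      quotients      : S · Inv S ⊆ Der ∪ ｛1｝

record SimpleDigraph (X : Set a) (ℓ : Level) : Set (a ⊔ suc ℓ) where
  field
    Arc    : Rel X ℓ
    irrefl : Irreflexive _≡_ Arc

IsSimpleGraph : {X : Set a} → SimpleDigraph X ℓ → Set (a ⊔ ℓ)
IsSimpleGraph Γ = Symmetric (SimpleDigraph.Arc Γ)

IsRegular : {X : Set a} → SimpleDigraph X ℓ → ℕ → Set (a ⊔ ℓ)
IsRegular {X = X} Γ k =
  ∀ x → HasSize (setoid X) (λ y → Arc x y) k × HasSize (setoid X) (λ y → Arc y x) k
  where open SimpleDigraph Γ

DA : (X : Set a) (S : Pred (X ↔ X) ℓ) → S ⊆ Der → SimpleDigraph X (a ⊔ ℓ)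
DA X S S⊆Der = record
  { Arc    = λ u v → ∃ λ s → s ∈ S × v ≡ u ^ s
  ; irrefl = λ { refl (s , s∈S , u≡uˢ) → S⊆Der s∈S _ (sym u≡uˢ) }
  }

{-# OPTIONS --safe #-}

-- For every x the map S → X, s ↦ xˢ, has the out-neighbourhood of x as its image, and it is
-- injective for all x exactly when distinct elements of S never agree at a point, which is
-- S S⁻¹ ⊆ Der(X) ∪ {1}. As S is finite, injectivity amounts to out-valency |S|: a surjection
-- between finite sets of equal size is injective. Symmetry of the arcs is x^S = x^(S⁻¹) for
-- all x, and it makes the in-neighbourhoods coincide with the out-neighbourhoods.
module Submission where

open import Defs
open import Algebra.Bundles using (Group)
open import Data.Fin.Base using (Fin; punchOut)
open import Data.Fin.Properties using (_≟_; any?; punchOut-injective; <⇒notInjective)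
open import Data.Nat.Base using (ℕ; suc)
open import Data.Nat.Properties using (n<1+n)
open import Data.Product.Base using (_×_; _,_; proj₁; proj₂; ∃)
open import Data.Sum.Base using (inj₁; inj₂)
open import Function.Base using (_∘_)
open import Function.Bundles using (_↔_; _⇔_; mk⇔; Inverse; Bijection)
open import Function.Definitions using (Injective; StrictlySurjective)
open import Level using (Level)
open import Relation.Binary.Bundles using (Setoid)
open import Relation.Binary.Definitions using (_Respects_)
open import Relation.Binary.PropositionalEquality
  using (_≡_; _≢_; refl; sym; trans; cong; setoid)
open import Relation.Nullary using (yes; no; contradiction)
open import Relation.Unary using (Pred; _∈_; _⊆_; _≐_; _∪_; Satisfiable)

private
  variable
    a ℓ ℓ₁ ℓ₂ : Level
    n : ℕ

-- Pigeonhole: if `f` missed `y`, punching `y` out of the codomain would leave an injection into a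
-- set with one element fewer.
injective⇒strictlySurjective : {f : Fin n → Fin n} →
  Injective _≡_ _≡_ f → StrictlySurjective _≡_ f
injective⇒strictlySurjective {n = suc n} {f} f-inj y with any? (λ i → f i ≟ y)
... | yes hit  = hit
... | no  miss = contradiction
  (λ {i} {j} eq → f-inj (punchOut-injective (y≢f i) (y≢f j) eq))
  (<⇒notInjective {f = λ i → punchOut (y≢f i)} (n<1+n n))
  where
  y≢f : ∀ i → y ≢ f i
  y≢f i y≡fi = miss (i , sym y≡fi)

module _ {B : Setoid ℓ₁ ℓ₂} (size : Bijection (setoid (Fin n)) B) where

  open Setoid B renaming (refl to ≈-refl; sym to ≈-sym; trans to ≈-trans)
  open Bijection size using (to; injective)

  -- Choosing preimages under f of the elements enumerated by size gives an injective, hence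
  -- surjective, map g on Fin n, so that i and j can be taken to be values of g.
  strictlySurjective⇒injective : {f : Fin n → Carrier} →
    StrictlySurjective _≈_ f → Injective _≡_ _≈_ f
  strictlySurjective⇒injective {f} f-surj {i} {j} fi≈fj = i≡j
    where
    g : Fin n → Fin n
    g k = proj₁ (f-surj (to k))

    fg≈to : ∀ k → f (g k) ≈ to k
    fg≈to k = proj₂ (f-surj (to k))

    fg-cancel : ∀ {k l} → f (g k) ≈ f (g l) → k ≡ l
    fg-cancel {k} {l} eq = injective (≈-trans (≈-sym (fg≈to k)) (≈-trans eq (fg≈to l)))

    f-cong : ∀ {i j} → i ≡ j → f i ≈ f j
    f-cong refl = ≈-refl

    i≡j : i ≡ j
    i≡j with k , refl ← injective⇒strictlySurjective {f = g} (fg-cancel ∘ f-cong) i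
           | l , refl ← injective⇒strictlySurjective {f = g} (fg-cancel ∘ f-cong) j
           = cong g (fg-cancel fi≈fj)

hasSize-resp-≐ : {A : Setoid a ℓ}
  {P : Pred (Setoid.Carrier A) ℓ₁} {Q : Pred (Setoid.Carrier A) ℓ₂} →
  P ≐ Q → HasSize A P n → HasSize A Q n
hasSize-resp-≐ (P⊆Q , Q⊆P) size = record
  { to        = λ i → proj₁ (to i) , P⊆Q (proj₂ (to i))
  ; cong      = cong′
  ; bijective = injective , λ (y , y∈Q) → surjective (y , Q⊆P y∈Q)
  }
  where open Bijection size using (to; injective; surjective) renaming (cong to cong′)

module _ {X : Set a} where

  open Group (Sym X) using (_≈_; _∙_; _⁻¹)

  ^-⁻¹-transpose : ∀ {x y} (s : X ↔ X) → x ≡ y ^ s → y ≡ x ^ (s ⁻¹)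
  ^-⁻¹-transpose s refl = sym (Inverse.strictlyInverseʳ s _)

  ⁻¹-^-transpose : ∀ {x y} (s : X ↔ X) → x ≡ y ^ (s ⁻¹) → y ≡ x ^ s
  ⁻¹-^-transpose s refl = sym (Inverse.strictlyInverseˡ s _)

  module _ (S : Pred (X ↔ X) ℓ) (S⊆Der : S ⊆ Der) where

    open SimpleDigraph (DA X S S⊆Der) using (Arc)

    Semiregular : Set _
    Semiregular = ∀ {s t} x → s ∈ S → t ∈ S → x ^ s ≡ x ^ t → s ≈ t

    -- `x ^ˢ Inv S` is the in-neighbourhood of `x`, because `x ≡ y ^ t` and `y ≡ x ^ (t ⁻¹)` are
    -- interchangeable; reversing arcs therefore gives both inclusions.
    symmetric⇒inverse-images : IsSimpleGraph (DA X S S⊆Der) → ∀ x → x ^ˢ S ≐ x ^ˢ Inv S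
    symmetric⇒inverse-images symm x = to , from
      where
      to : x ^ˢ S ⊆ x ^ˢ Inv S
      to xy with t , t∈S , x≡yᵗ ← symm xy =
        t ⁻¹ , (t , t∈S , λ _ → refl) , ^-⁻¹-transpose t x≡yᵗ

      from : x ^ˢ Inv S ⊆ x ^ˢ S
      from (p , (t , t∈S , p≈t⁻¹) , y≡xᵖ) =
        symm (t , t∈S , ⁻¹-^-transpose t (trans y≡xᵖ (p≈t⁻¹ x)))

    inverse-images⇒symmetric : (∀ x → x ^ˢ S ≐ x ^ˢ Inv S) → IsSimpleGraph (DA X S S⊆Der)
    inverse-images⇒symmetric inverse-images {x} xy
      with p , (t , t∈S , p≈t⁻¹) , y≡xᵖ ← proj₁ (inverse-images x) xy =
      t , t∈S , ⁻¹-^-transpose t (trans y≡xᵖ (p≈t⁻¹ x))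

    -- If `s` and `t` agree at `x`, then `s ∙ t ⁻¹` fixes `x`, so it is not a derangement and must
    -- be the identity.
    quotients⇒semiregular : S · Inv S ⊆ Der ∪ ｛1｝ → Semiregular
    quotients⇒semiregular quotients {s} {t} x s∈S t∈S xˢ≡xᵗ
      with quotients {s ∙ t ⁻¹} (s , t ⁻¹ , s∈S , (t , t∈S , λ _ → refl) , λ _ → refl)
    ... | inj₁ der = contradiction (sym (^-⁻¹-transpose t xˢ≡xᵗ)) (der x)
    ... | inj₂ s∙t⁻¹≈1 = λ y → ⁻¹-^-transpose t (sym (s∙t⁻¹≈1 y))

    module _ (size : HasSize (Group.setoid (Sym X)) S n) where

      open Bijection size using (to; injective; strictlySurjective)

      outNeighbour : ∀ x → Fin n → ∃ (Arc x)
      outNeighbour x i = x ^ proj₁ (to i) , proj₁ (to i) , proj₂ (to i) , refl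

      outNeighbour-surjective : ∀ x (y : ∃ (Arc x)) →
        ∃ λ i → proj₁ (outNeighbour x i) ≡ proj₁ y
      outNeighbour-surjective x (y , s , s∈S , y≡xˢ)
        with i , sᵢ≈s ← strictlySurjective (s , s∈S) = i , trans (sᵢ≈s x) (sym y≡xˢ)

      -- Agreement of s and t at a point is not decidable, but equality of their indices is.
      outValency⇒quotients : (∀ x → HasSize (setoid X) (Arc x) n) → S · Inv S ⊆ Der ∪ ｛1｝
      outValency⇒quotients valency {p} (s , q , s∈S , (t , t∈S , q≈t⁻¹) , p≈sq)
        with i , sᵢ≈s ← strictlySurjective (s , s∈S)
           | j , sⱼ≈t ← strictlySurjective (t , t∈S)
        with p≈s∙t⁻¹ ← (λ x → trans (p≈sq x) (q≈t⁻¹ (x ^ s)))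
        with i ≟ j
      ... | yes refl = inj₂ λ x →
              trans (p≈s∙t⁻¹ x) (sym (^-⁻¹-transpose t (trans (sym (sᵢ≈s x)) (sⱼ≈t x))))
      -- A fixed point `x` of `p` gives `x ^ s ≡ x ^ t`, so the distinct indices `i` and `j` yield
      -- the same out-neighbour of `x`. But `outNeighbour x` maps `Fin n` onto a set of size `n`,
      -- hence is injective.
      ... | no i≢j = inj₁ λ x xᵖ≡x → i≢j
              (strictlySurjective⇒injective (valency x) {f = outNeighbour x}
                (outNeighbour-surjective x)
                (trans (sᵢ≈s x) (trans
                  (⁻¹-^-transpose t (trans (sym xᵖ≡x) (p≈s∙t⁻¹ x)))
                  (sym (sⱼ≈t x)))))

      -- Evaluating the enumeration of `S` at `x` lists the out-neighbours without repetition: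
      -- agreement at `x` forces equal permutations, hence equal indices.
      semiregular⇒outValency : Semiregular → ∀ x → HasSize (setoid X) (Arc x) n
      semiregular⇒outValency semiregular x = record
        { to        = outNeighbour x
        ; cong      = λ { refl → refl }
        ; bijective =
            (λ {i} {j} eq → injective (semiregular x (proj₂ (to i)) (proj₂ (to j)) eq))
          , λ y → proj₁ (outNeighbour-surjective x y)
                , λ { refl → proj₂ (outNeighbour-surjective x y) }
        }

theorem1p8 : {a ℓ : Level} (X : Set a) (x₀ : X)
    (S : Pred (X ↔ X) ℓ) → S Respects (Group._≈_ (Sym X)) →
    (S⊆Der : S ⊆ Der) → Satisfiable S →
    (n : ℕ) → HasSize (Group.setoid (Sym X)) S n →
    (IsSimpleGraph (DA X S S⊆Der) × IsRegular (DA X S S⊆Der) n) ⇔ Closed S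
theorem1p8 X x₀ S S-resp S⊆Der S-nonempty n size = mk⇔ closed regular
  where
  Γ = DA X S S⊆Der

  closed : IsSimpleGraph Γ × IsRegular Γ n → Closed S
  closed (symmetric , regular) = record
    { inverse-images = symmetric⇒inverse-images S S⊆Der symmetric
    ; quotients      = λ {p} → outValency⇒quotients S S⊆Der size (proj₁ ∘ regular) {p}
    }

  regular : Closed S → IsSimpleGraph Γ × IsRegular Γ n
  regular closedS =
    symmetric , λ x → outValency x ,
      -- Reversing arcs carries out-neighbours of `x` to in-neighbours and back, so the two sets
      -- have the same size.
      hasSize-resp-≐ {A = setoid X} (symmetric , symmetric) (outValency x)
    where
    open Closed closedS

    symmetric : IsSimpleGraph Γ
    symmetric = inverse-images⇒symmetric S S⊆Der inverse-images

    outValency : ∀ x → HasSize (setoid X) (SimpleDigraph.Arc Γ x) n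
    outValency = semiregular⇒outValency S S⊆Der size
      (quotients⇒semiregular S S⊆Der λ {p} → quotients {p})
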